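{- (1) $Q^{1}_{\mathrm{Mon}}\mathrm{FO}(+,\times)\equiv Q^{\star}_{\mathrm{Mon}}\mathrm{FO}(+,\times)$. (2) $\mathrm{SOM}(Q^{1}_{\mathrm{Mon}},+,\times)\equiv\mathrm{SOM}(Q^{\star}_{\mathrm{Mon}},+,\times)$.
   Context: Strings as structures: a nonempty string $b_0\cdots b_{n-1}$ over the ordered alphabet $(a_1,\dots,a_s)$ is the structure with universe $\{0,\dots,n-1\}$, natural order $<$, and unary predicates $P_{a_i}=\{j:b_j=a_i\}$. FO uses $=$, $<$, these predicates, $\min,\max$, connectives, $\exists,\forall$; SOM adds unary second-order variables and quantifiers. "$+,\times$" means the ternary relations $i+j=k$ and $i\cdot j=k$ are additionally built in. Monadic second-order Lindström quantifiers: for a language $L$ over $(a_1,\dots,a_s)$ and distinct unary variables $\overline X=(X_1,\dots,X_k)$, over universe $\{0,\dots,n-1\}$ and an assignment $(A_1,\dots,A_k)$ let $s^i_j=1$ iff $j\in A_i$. For $Q^1_L$ the $2^{nk}$ assignments are ordered lexicographically by the interleaved code $s^1_0\cdots s^k_0s^1_1\cdots s^k_1\cdots s^1_{n-1}\cdots s^k_{n-1}$; for $Q^\star_L$ by the concatenated code $s^1_0\cdots s^1_{n-1}\cdots s^k_0\cdots s^k_{n-1}$. Then $\mathcal A\models Q\overline X[\varphi_1,\dots,\varphi_{s-1}]$ iff the word of length $2^{nk}$ whose $i$-th letter is $a_j$ for the least $j$ with $\varphi_j$ true at the $i$-th assignment (and $a_s$ if none) lies in $L$. A monoid is a finite set $M$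 with an associative binary operation with identity; for $S\subseteq M$, the word-problem $\mathcal W(S,M)$ is the set of words over alphabet $M$ whose product lies in $S$. $Q^{1}_{\mathrm{Mon}}\mathrm{FO}(+,\times)$ (resp. $Q^{\star}_{\mathrm{Mon}}\mathrm{FO}(+,\times)$) consists of formulas $Q^1_L\overline X[\varphi_1,\dots,\varphi_{s-1}]$ (resp. with $Q^\star_L$), $L$ a monoid word-problem, $\varphi_i$ first-order with built-in $+,\times$. $\mathrm{SOM}(Q^{1}_{\mathrm{Mon}},+,\times)$ (resp. with $\star$) is SOM with built-in $+,\times$ closed under nested application of $Q^1_L$ (resp. $Q^\star_L$) for monoid word-problems $L$. $\mathcal L\equiv\mathcal L'$ means that over every string signature every sentence of either logic has an equivalent sentence of the other. -}

module Defs where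

open import Algebra.Core using (Op₂)
open import Algebra.Structures using (IsMonoid)
open import Data.Bool.Base using (Bool; true; false)
open import Data.Fin.Base as Fin using (Fin; toℕ; fromℕ)
open import Data.Fin.Subset using (Subset; _∈_)
open import Data.List.Base as List using (List; []; _∷_)
open import Data.List.Relation.Binary.Pointwise.Base using (Pointwise)
open import Data.Nat.Base using (ℕ; zero; suc; _+_; _*_)
open import Data.Product.Base using (∃-syntax; _×_)
open import Data.Sum.Base using (_⊎_)
open import Data.Vec.Base as Vec using (Vec; lookup)
open import Function.Bundles using (_⇔_)
open import Level using (0ℓ)
open import Relation.Binary.PropositionalEquality.Core using (_≡_)
open import Relation.Nullary.Negation.Core using (¬_)
open import Relation.Unary using (Pred)

-- A string over an ordered alphabet of s letters; the last index is the
-- length minus one, so strings are nonempty.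
Str : ℕ → ℕ → Set
Str s n = Vec (Fin s) (suc n)

Language : ℕ → Set₁
Language s = Pred (List (Fin s)) 0ℓ

-- The finite set is presented as Fin (suc size-1), so a value of this record
-- is a finite monoid together with an ordering a₁, …, aₛ of its elements;
-- every ordering arises, as the multiplication table is arbitrary.
record FiniteMonoid : Set where
  infixl 7 _∙_
  field
    size-1 : ℕ

  Carrier : Set
  Carrier = Fin (suc size-1)

  field
    _∙_      : Op₂ Carrier
    ε        : Carrier
    isMonoid : IsMonoid _≡_ _∙_ ε

  product : List Carrier → Carrier
  product = List.foldr _∙_ ε

open FiniteMonoid using (size-1; product)

wordProblem : (M : FiniteMonoid) → Subset (suc (size-1 M)) → Language (suc (size-1 M))
wordProblem M S w = product M w ∈ S

data Variant : Set where
  one star : Variant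

-- Row i of the vector is the characteristic vector of Aᵢ, so concatenating
-- the rows gives s¹₀⋯s¹ₙ₋₁⋯sᵏ₀⋯sᵏₙ₋₁ and concatenating the columns gives
-- s¹₀⋯sᵏ₀⋯s¹ₙ₋₁⋯sᵏₙ₋₁.
code : ∀ {n k} → Variant → Vec (Subset n) k → List Bool
code one  As = Vec.toList (Vec.concat (Vec.transpose As))
code star As = Vec.toList (Vec.concat As)

-- All 0-1 words of length N, in lexicographic order.
lexWords : ℕ → List (List Bool)
lexWords zero    = [] ∷ []
lexWords (suc N) = List.map (false ∷_) (lexWords N) List.++ List.map (true ∷_) (lexWords N)

-- a is the letter a_j for the least j such that P j holds, and the last
-- letter of the alphabet if there is no such j.
IsLetter : ∀ {s} → (Fin s → Set) → Fin (suc s) → Set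
IsLetter P a = (∀ j → toℕ j ≡ toℕ a → P j) × (∀ j → j Fin.< a → ¬ P j)

-- Truth of Q_L X̄ [φ₁, …, φₛ₋₁], where P As j says that φⱼ is true at the
-- assignment As. The assignment with a given code is unique, as is the word w.
Lindström : ∀ {s} → Variant → Language (suc s) →
            ∀ n k → (Vec (Subset n) k → Fin s → Set) → Set
Lindström q L n k P =
  ∃[ w ] Pointwise (λ c a → ∃[ As ] code q As ≡ c × IsLetter (P As) a) (lexWords (n * k)) w
       × L w

data Term (v : ℕ) : Set where
  var     : Fin v → Term v
  min max : Term v

-- FO is FO(+,×), in which set variables may occur free but not be quantified;
-- SOM q is SOM(Q_Mon,+,×) with the variant q of the monoid quantifiers.
data Logic : Set where
  FO  : Logic
  SOM : Variant → Logic

-- De Bruijn syntax: v first-order and k unary second-order variables in scope.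
data Formula (s : ℕ) : Logic → ℕ → ℕ → Set where
  _≐_ _≺_       : ∀ {ℒ v k} → Term v → Term v → Formula s ℒ v k
  letter        : ∀ {ℒ v k} → Fin s → Term v → Formula s ℒ v k
  member        : ∀ {ℒ v k} → Fin k → Term v → Formula s ℒ v k
  plus times    : ∀ {ℒ v k} → Term v → Term v → Term v → Formula s ℒ v k
  neg           : ∀ {ℒ v k} → Formula s ℒ v k → Formula s ℒ v k
  and or imp    : ∀ {ℒ v k} → Formula s ℒ v k → Formula s ℒ v k → Formula s ℒ v k
  exists forAll : ∀ {ℒ v k} → Formula s ℒ (suc v) k → Formula s ℒ v k
  existsSet forAllSet : ∀ {q v k} → Formula s (SOM q) v (suc k) → Formula s (SOM q) v k
  -- Binds the suc ℓ set variables X₁, …, X_{ℓ+1}, which become the first ones in scope.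
  monoidQ       : ∀ {q v k} (M : FiniteMonoid) (S : Subset (suc (size-1 M))) (ℓ : ℕ) →
                  (Fin (size-1 M) → Formula s (SOM q) v (suc ℓ + k)) → Formula s (SOM q) v k

value : ∀ {n v} → Vec (Fin (suc n)) v → Term v → Fin (suc n)
value     ρ (var x) = lookup ρ x
value     ρ min     = Fin.zero
value {n} ρ max     = fromℕ n

Sat : ∀ {s n ℒ v k} → Str s n → Vec (Fin (suc n)) v → Vec (Subset (suc n)) k →
      Formula s ℒ v k → Set
Sat b ρ σ (t ≐ u)       = value ρ t ≡ value ρ u
Sat b ρ σ (t ≺ u)       = value ρ t Fin.< value ρ u
Sat b ρ σ (letter a t)  = lookup b (value ρ t) ≡ a
Sat b ρ σ (member X t)  = value ρ t ∈ lookup σ X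
Sat b ρ σ (plus t u r)  = toℕ (value ρ t) + toℕ (value ρ u) ≡ toℕ (value ρ r)
Sat b ρ σ (times t u r) = toℕ (value ρ t) * toℕ (value ρ u) ≡ toℕ (value ρ r)
Sat b ρ σ (neg φ)       = ¬ Sat b ρ σ φ
Sat b ρ σ (and φ ψ)     = Sat b ρ σ φ × Sat b ρ σ ψ
Sat b ρ σ (or φ ψ)      = Sat b ρ σ φ ⊎ Sat b ρ σ ψ
Sat b ρ σ (imp φ ψ)     = Sat b ρ σ φ → Sat b ρ σ ψ
Sat b ρ σ (exists φ)    = ∃[ i ] Sat b (i Vec.∷ ρ) σ φ
Sat b ρ σ (forAll φ)    = ∀ i → Sat b (i Vec.∷ ρ) σ φ
Sat b ρ σ (existsSet φ) = ∃[ A ] Sat b ρ (A Vec.∷ σ) φ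
Sat b ρ σ (forAllSet φ) = ∀ A → Sat b ρ (A Vec.∷ σ) φ
Sat {n = n} {ℒ = SOM q} b ρ σ (monoidQ M S ℓ φ) =
  Lindström q (wordProblem M S) (suc n) (suc ℓ) (λ As j → Sat b ρ (As Vec.++ σ) (φ j))

-- A sentence Q_L X̄ [φ₁, …, φₛ₋₁] with L = 𝓦(S, M), |X̄| = ℓ + 1 and φⱼ first-order.
record MonoidFOSentence (s : ℕ) : Set where
  field
    M : FiniteMonoid
    S : Subset (suc (size-1 M))
    ℓ : ℕ
    φ : Fin (size-1 M) → Formula s FO 0 (suc ℓ)

record StringLogic : Set₁ where
  field
    Sentence : ℕ → Set
    Models   : ∀ {s n} → Str s n → Sentence s → Set

QMonFO : Variant → StringLogic
QMonFO q = record
  { Sentence = MonoidFOSentence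
  ; Models   = λ {_} {n} b Φ → let open MonoidFOSentence Φ in
      Lindström q (wordProblem M S) (suc n) (suc ℓ) (λ As j → Sat b Vec.[] As (φ j))
  }

SOMQMon : Variant → StringLogic
SOMQMon q = record
  { Sentence = λ s → Formula s (SOM q) 0 0
  ; Models   = λ b φ → Sat b Vec.[] Vec.[] φ
  }

infix 4 _⊑_ _≋_

_⊑_ : StringLogic → StringLogic → Set
𝓛 ⊑ 𝓛′ = ∀ s (φ : 𝓛.Sentence s) → ∃[ ψ ] (∀ {n} (b : Str s n) → 𝓛.Models b φ ⇔ 𝓛′.Models b ψ)
  where
  module 𝓛  = StringLogic 𝓛
  module 𝓛′ = StringLogic 𝓛′

_≋_ : StringLogic → StringLogic → Set
𝓛 ≋ 𝓛′ = (𝓛 ⊑ 𝓛′) × (𝓛′ ⊑ 𝓛)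

{-# OPTIONS --safe #-}
-- Both codes of k subsets of an n-element universe are bit strings of length
-- n * k.  Reading one and the same string with either code turns an assignment A
-- into an assignment B, and the i-th bit at j in A is the m-th bit at r in B
-- exactly if k * j + i = n * m + r (up to exchanging the roles of A and B).
-- As k, i and m are constants, this equation is definable in FO(+): add up the
-- left-hand side one summand at a time, keeping only the remainder modulo n as
-- an element of the universe and the number of carries in the formula.  Hence
-- replacing the atoms X i (t) by their definition in terms of B turns a
-- quantifier of one kind into one of the other kind for the same language.
module Submission where

open import Defs
open import Data.Bool.Base using (Bool)
open import Data.Fin.Base as Fin using (Fin; toℕ; fromℕ; fromℕ<; combine; splitAt; _↑ˡ_; _↑ʳ_)
open import Data.Fin.Properties using (toℕ<n; toℕ-fromℕ; toℕ-fromℕ<; toℕ-injective; toℕ-combine; toℕ-cast; combine-surjective)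
open import Data.Fin.Subset using (Subset; _∈_)
open import Data.List.Properties using (∷-injective)
open import Data.List.Relation.Binary.Pointwise.Base as Pointwise using ()
open import Data.Nat.Base using (ℕ; zero; suc; _+_; _*_; _∸_; _≤_; _<_; z≤n; s≤s; s≤s⁻¹)
open import Data.Nat.Properties
open import Data.Product.Base using (∃-syntax; _×_; _,_)
open import Data.Product.Function.Dependent.Propositional using () renaming (congˡ to ∃-cong)
open import Data.Product.Function.NonDependent.Propositional using (_×-⇔_)
open import Data.Sum.Base using (inj₁; inj₂; [_,_]′)
open import Data.Sum.Function.Propositional using (_⊎-⇔_)
open import Data.Vec.Base as Vec using (Vec; []; _∷_; lookup)
open import Data.Vec.Properties using (lookup∘tabulate; tabulate∘lookup; tabulate-cong; lookup-concat; lookup-⊛; lookup-replicate; lookup-splitAt; lookup-++ˡ; lookup-++ʳ; toList-cast; []=⇒lookup; lookup⇒[]=)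
open import Function.Base using (_∘_)
open import Function.Bundles using (_⇔_; mk⇔; module Equivalence)
open import Function.Properties.Equivalence using () renaming (refl to ⇔-refl; sym to ⇔-sym; trans to ⇔-trans)
open import Function.Related.TypeIsomorphisms using (→-cong-⇔; ¬-cong-⇔)
open import Relation.Binary.PropositionalEquality
open import Relation.Nullary.Decidable.Core using (yes; no)
open import Relation.Nullary.Negation.Core using (contradiction)

open Equivalence using (to; from)

∀-cong : {A : Set} {P Q : A → Set} → (∀ x → P x ⇔ Q x) → (∀ x → P x) ⇔ (∀ x → Q x)
∀-cong P⇔Q = mk⇔ (λ p x → to (P⇔Q x) (p x)) (λ q x → from (P⇔Q x) (q x))

≡⇒⇔ : {A B : Set} → A ≡ B → A ⇔ B
≡⇒⇔ refl = ⇔-refl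

flip : Variant → Variant
flip one  = star
flip star = one

-- Codes

codeLength : Variant → ℕ → ℕ → ℕ
codeLength one  n k = n * k
codeLength star n k = k * n

bits : ∀ {n k} q → Vec (Subset n) k → Vec Bool (codeLength q n k)
bits one  As = Vec.concat (Vec.transpose As)
bits star As = Vec.concat As

code≡bits : ∀ {n k} q (As : Vec (Subset n) k) → code q As ≡ Vec.toList (bits q As)
code≡bits one  As = refl
code≡bits star As = refl

-- As a number this is `k * j + i` in the interleaved code and `n * i + j` in the concatenated one.
index : ∀ {n k} q → Fin k → Fin n → Fin (codeLength q n k)
index one  i j = combine j i
index star i j = combine i j

index-surjective : ∀ {n k} q (p : Fin (codeLength q n k)) → ∃[ i ] ∃[ j ] index q i j ≡ p
index-surjective {n} {k} one p with j , i , eq ← combine-surjective {n} {k} p = i , j , eq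
index-surjective {n} {k} star p = combine-surjective {k} {n} p

-- Positions are compared as numbers because `n * k` and `k * n` give different types of positions.
SamePosition : ∀ {n k} → Variant → Fin k → Fin n → Fin k → Fin n → Set
SamePosition q i j m r = toℕ (index q i j) ≡ toℕ (index (flip q) m r)

lookup-transpose : ∀ {A : Set} {m n} (xss : Vec (Vec A n) m) i j →
                   lookup (lookup (Vec.transpose xss) j) i ≡ lookup (lookup xss i) j
lookup-transpose {A} {suc m} {n} (xs ∷ xss) i j = trans (cong (λ ys → lookup ys i) row) (entry i)
  where
  open ≡-Reasoning

  cons : Vec (A → Vec A m → Vec A (suc m)) n
  cons = Vec.replicate n _∷_

  row : lookup (Vec.transpose (xs ∷ xss)) j ≡ lookup xs j ∷ lookup (Vec.transpose xss) j
  row = begin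
    lookup (cons Vec.⊛ xs Vec.⊛ Vec.transpose xss) j              ≡⟨ lookup-⊛ j (cons Vec.⊛ xs) (Vec.transpose xss) ⟩
    lookup (cons Vec.⊛ xs) j (lookup (Vec.transpose xss) j)       ≡⟨ cong (λ f → f (lookup (Vec.transpose xss) j)) (lookup-⊛ j cons xs) ⟩
    lookup cons j (lookup xs j) (lookup (Vec.transpose xss) j)    ≡⟨ cong (λ f → f (lookup xs j) (lookup (Vec.transpose xss) j)) (lookup-replicate j _∷_) ⟩
    lookup xs j ∷ lookup (Vec.transpose xss) j                    ∎

  entry : ∀ i → lookup (lookup xs j ∷ lookup (Vec.transpose xss) j) i ≡ lookup (lookup (xs ∷ xss) i) j
  entry Fin.zero    = refl
  entry (Fin.suc i) = lookup-transpose xss i j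

lookup-bits : ∀ {n k} q (As : Vec (Subset n) k) i j →
              lookup (bits q As) (index q i j) ≡ lookup (lookup As i) j
lookup-bits one  As i j = trans (lookup-concat (Vec.transpose As) j i) (lookup-transpose As i j)
lookup-bits star As i j = lookup-concat As i j

-- The sets are read off from `xs` at the positions `index q i j`; these exhaust all positions, so
-- no bit is left undetermined.
bits-surjective : ∀ {n k} q (xs : Vec Bool (codeLength q n k)) → ∃[ As ] bits {n} {k} q As ≡ xs
bits-surjective {n} {k} q xs = As , (begin
  bits q As                         ≡⟨ tabulate∘lookup (bits q As) ⟨
  Vec.tabulate (lookup (bits q As)) ≡⟨ tabulate-cong lookup-≡ ⟩
  Vec.tabulate (lookup xs)          ≡⟨ tabulate∘lookup xs ⟩
  xs                                ∎)
  where
  open ≡-Reasoning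

  As : Vec (Subset n) k
  As = Vec.tabulate λ i → Vec.tabulate λ j → lookup xs (index q i j)

  lookup-≡ : ∀ p → lookup (bits q As) p ≡ lookup xs p
  lookup-≡ p with i , j , refl ← index-surjective {n} {k} q p = begin
    lookup (bits q As) (index q i j) ≡⟨ lookup-bits q As i j ⟩
    lookup (lookup As i) j           ≡⟨ cong (λ A → lookup A j) (lookup∘tabulate _ i) ⟩
    lookup (Vec.tabulate _) j        ≡⟨ lookup∘tabulate _ j ⟩
    lookup xs (index q i j)          ∎

codeLength-flip : ∀ q n k → codeLength q n k ≡ codeLength (flip q) n k
codeLength-flip one  n k = *-comm n k
codeLength-flip star n k = *-comm k n

-- The two code lengths differ only by commutativity, so the cast leaves the word unchanged and it
-- can be decoded in the other variant.
recode : ∀ {n k} q (As : Vec (Subset n) k) → ∃[ Bs ] code (flip q) Bs ≡ code q As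
recode {n} {k} q As with Bs , eq ← bits-surjective (flip q) (Vec.cast (codeLength-flip q n k) (bits q As)) = Bs , (begin
  code (flip q) Bs                                             ≡⟨ code≡bits (flip q) Bs ⟩
  Vec.toList (bits (flip q) Bs)                                ≡⟨ cong Vec.toList eq ⟩
  Vec.toList (Vec.cast (codeLength-flip q n k) (bits q As))    ≡⟨ toList-cast _ (bits q As) ⟩
  Vec.toList (bits q As)                                       ≡⟨ code≡bits q As ⟨
  code q As                                                    ∎)
  where open ≡-Reasoning

-- Codes of different variants can be equated only as lists; this recovers the equality of single
-- bits.
toList-lookup : ∀ {A : Set} {m n} (xs : Vec A m) (ys : Vec A n) {i j} →
                Vec.toList xs ≡ Vec.toList ys → toℕ i ≡ toℕ j → lookup xs i ≡ lookup ys j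
toList-lookup (x ∷ xs) (y ∷ ys) {Fin.zero}  {Fin.zero}  eq _ with refl , _ ← ∷-injective eq = refl
toList-lookup (x ∷ xs) (y ∷ ys) {Fin.suc i} {Fin.suc j} eq i≡j with _ , eq′ ← ∷-injective eq =
  toList-lookup xs ys eq′ (suc-injective i≡j)

-- Definability of the change of code

wk : ∀ {v} → Term v → Term (suc v)
wk (var x) = var (Fin.suc x)
wk min     = min
wk max     = max

value-wk : ∀ {n v} (i : Fin (suc n)) (ρ : Vec (Fin (suc n)) v) t → value (i ∷ ρ) (wk t) ≡ value ρ t
value-wk i ρ (var x) = refl
value-wk i ρ min     = refl
value-wk i ρ max     = refl

module _ {s : ℕ} {ℒ : Logic} where

  -- The number 1 is not a term, and a one-element universe does not contain it, so the successor is
  -- described through the order.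
  isSuc : ∀ {v k} → Term v → Term v → Formula s ℒ v k
  isSuc t u = and (t ≺ u) (forAll (imp (wk t ≺ var Fin.zero) (neg (var Fin.zero ≺ wk u))))

  -- t + u ≡ r + n for the size n of the universe.
  plusWraps : ∀ {v k} → Term v → Term v → Term v → Formula s ℒ v k
  plusWraps t u r =
    exists (and (plus (var Fin.zero) (wk u) max)
                (exists (and (plus (wk (wk r)) (var (Fin.suc Fin.zero)) (var Fin.zero))
                             (isSuc (var Fin.zero) (wk (wk t))))))

  -- One addition modulo the size of the universe. The quantified element is the remainder before
  -- the addition; the quotient before it was the same (`stay`) or one less (`wrap`), and quotient
  -- zero rules out the latter.
  addStep : ∀ {v k} (stay wrap : Formula s ℒ (suc v) k) → (ℕ → Formula s ℒ (suc v) k) → ℕ → Formula s ℒ v k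
  addStep stay wrap φ zero    = exists (and (φ zero) stay)
  addStep stay wrap φ (suc m) = exists (or (and (φ (suc m)) stay) (and (φ m) wrap))

  -- c * t + i ≡ m * n + r for the size n of the universe.
  linear : ∀ {v k} → ℕ → ℕ → ℕ → Term v → Term v → Formula s ℒ v k
  linear c (suc i) m t r =
    addStep (isSuc (var Fin.zero) (wk r)) (and (var Fin.zero ≐ max) (wk r ≐ min))
            (λ m → linear c i m (wk t) (var Fin.zero)) m
  linear (suc c) zero m t r =
    addStep (plus (var Fin.zero) (wk t) (wk r)) (plusWraps (var Fin.zero) (wk t) (wk r))
            (λ m → linear c zero m (wk t) (var Fin.zero)) m
  linear zero zero zero    t r = r ≐ min
  linear zero zero (suc m) t r = min ≺ min

  -- `linear` has the interleaved position on its left, so for `star` the two pairs exchange places.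
  samePosition : ∀ {v k K} → Variant → Fin K → Term v → Fin K → Term v → Formula s ℒ v k
  samePosition {K = K} one  i t m r = linear K (toℕ i) (toℕ m) t r
  samePosition {K = K} star i t m r = linear K (toℕ m) (toℕ i) r t

  -- A disjunction of constant length. The syntax has no falsity, so `min ≺ min` serves as the empty
  -- disjunction.
  someIndex : ∀ {v k} K → (Fin K → Formula s ℒ v k) → Formula s ℒ v k
  someIndex zero    φ = min ≺ min
  someIndex (suc K) φ = or (φ Fin.zero) (someIndex K (φ ∘ Fin.suc))

  -- Correctness of the arithmetic formulas

  module _ {n : ℕ} (b : Str s n) where

    isSuc⇔ : ∀ {v k} ρ (σ : Vec (Subset (suc n)) k) (t u : Term v) →
             Sat b ρ σ (isSuc t u) ⇔ suc (toℕ (value ρ t)) ≡ toℕ (value ρ u)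
    isSuc⇔ ρ σ t u = mk⇔ to′ from′
      where
      to′ : Sat b ρ σ (isSuc t u) → suc (toℕ (value ρ t)) ≡ toℕ (value ρ u)
      to′ (t<u , none) with m≤n⇒m<n∨m≡n t<u
      ... | inj₂ eq = eq
      -- Otherwise the number after `t` is still in the universe and lies strictly between `t` and
      -- `u`.
      ... | inj₁ t+1<u = contradiction
        (subst₂ _<_ (sym z≡) (cong toℕ (sym (value-wk z ρ u))) t+1<u)
        (none z (subst₂ _<_ (cong toℕ (sym (value-wk z ρ t))) (sym z≡) (n<1+n _)))
        where
        z<n : suc (toℕ (value ρ t)) < suc n
        z<n = <-trans t+1<u (toℕ<n (value ρ u))
        z = fromℕ< z<n
        z≡ : toℕ z ≡ suc (toℕ (value ρ t))
        z≡ = toℕ-fromℕ< z<n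

      from′ : suc (toℕ (value ρ t)) ≡ toℕ (value ρ u) → Sat b ρ σ (isSuc t u)
      from′ eq = ≤-reflexive eq , λ z t<z z<u → <-irrefl eq
        (≤-<-trans (subst (_< toℕ z) (cong toℕ (value-wk z ρ t)) t<z)
                   (subst (toℕ z <_) (cong toℕ (value-wk z ρ u)) z<u))

    -- The sum itself may leave the universe. With the complement `c = n - u` the equation becomes
    -- `t = r + c + 1`, and its partial sum `d = r + c` is below `t`, hence an element.
    plusWraps⇔ : ∀ {v k} ρ (σ : Vec (Subset (suc n)) k) (t u r : Term v) →
                 Sat b ρ σ (plusWraps t u r) ⇔
                 toℕ (value ρ t) + toℕ (value ρ u) ≡ suc n + toℕ (value ρ r)
    plusWraps⇔ ρ σ t u r = mk⇔ to′ from′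
      where
      T = toℕ (value ρ t)
      U = toℕ (value ρ u)
      R = toℕ (value ρ r)

      wk² : ∀ c d x → toℕ (value (d ∷ c ∷ ρ) (wk (wk x))) ≡ toℕ (value ρ x)
      wk² c d x = cong toℕ (trans (value-wk d (c ∷ ρ) (wk x)) (value-wk c ρ x))

      U≤n : U ≤ n
      U≤n = s≤s⁻¹ (toℕ<n (value ρ u))

      to′ : Sat b ρ σ (plusWraps t u r) → T + U ≡ suc n + R
      to′ (c , c+u , d , r+c , d+1) = begin
        T + U                     ≡⟨ cong (_+ U) T≡ ⟩
        suc (R + toℕ c) + U       ≡⟨ cong suc (+-assoc R (toℕ c) U) ⟩
        suc (R + (toℕ c + U))     ≡⟨ cong (λ x → suc (R + x)) c+u′ ⟩
        suc (R + n)               ≡⟨ cong suc (+-comm R n) ⟩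
        suc n + R                 ∎
        where
        open ≡-Reasoning
        c+u′ : toℕ c + U ≡ n
        c+u′ = trans (cong (λ x → toℕ c + toℕ x) (sym (value-wk c ρ u))) (trans c+u (toℕ-fromℕ n))
        T≡ : T ≡ suc (R + toℕ c)
        T≡ = begin
          T              ≡⟨ wk² c d t ⟨
          _              ≡⟨ to (isSuc⇔ (d ∷ c ∷ ρ) σ (var Fin.zero) (wk (wk t))) d+1 ⟨
          suc (toℕ d)    ≡⟨ cong suc r+c ⟨
          _              ≡⟨ cong (λ x → suc (x + toℕ c)) (wk² c d r) ⟩
          suc (R + toℕ c) ∎

      from′ : T + U ≡ suc n + R → Sat b ρ σ (plusWraps t u r)
      from′ eq = c , c+u , d , r+c , from (isSuc⇔ (d ∷ c ∷ ρ) σ (var Fin.zero) (wk (wk t))) d+1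
        where
        open ≡-Reasoning
        T≡ : suc (R + (n ∸ U)) ≡ T
        T≡ = +-cancelʳ-≡ U _ _ (begin
          suc (R + (n ∸ U)) + U   ≡⟨ cong suc (+-assoc R (n ∸ U) U) ⟩
          suc (R + (n ∸ U + U))   ≡⟨ cong (λ x → suc (R + x)) (m∸n+n≡m U≤n) ⟩
          suc (R + n)             ≡⟨ cong suc (+-comm R n) ⟩
          suc n + R               ≡⟨ eq ⟨
          T + U                   ∎)
        c<n : n ∸ U < suc n
        c<n = s≤s (m∸n≤m n U)
        d<n : R + (n ∸ U) < suc n
        d<n = <-trans (≤-reflexive T≡) (toℕ<n (value ρ t))
        c = fromℕ< c<n
        d = fromℕ< d<n
        c+u : toℕ c + toℕ (value (c ∷ ρ) (wk u)) ≡ toℕ (fromℕ n)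
        c+u = begin
          toℕ c + toℕ (value (c ∷ ρ) (wk u)) ≡⟨ cong₂ _+_ (toℕ-fromℕ< c<n) (cong toℕ (value-wk c ρ u)) ⟩
          n ∸ U + U                          ≡⟨ m∸n+n≡m U≤n ⟩
          n                                  ≡⟨ toℕ-fromℕ n ⟨
          toℕ (fromℕ n)                      ∎
        r+c : toℕ (value (d ∷ c ∷ ρ) (wk (wk r))) + toℕ c ≡ toℕ d
        r+c = trans (cong₂ _+_ (wk² c d r) (toℕ-fromℕ< c<n)) (sym (toℕ-fromℕ< d<n))
        d+1 : suc (toℕ d) ≡ toℕ (value (d ∷ c ∷ ρ) (wk (wk t)))
        d+1 = trans (cong suc (toℕ-fromℕ< d<n)) (trans T≡ (sym (wk² c d t)))

    -- Adding at most `suc n` to a remainder below `suc n` produces at most one carry, so the two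
    -- cases of `addStep` are exhaustive.
    addStep⇔ : ∀ {v k} ρ (σ : Vec (Subset (suc n)) k) {stay wrap : Formula s ℒ (suc v) k} {φ : ℕ → Formula s ℒ (suc v) k}
               {y z} (r : Fin (suc n)) → z ≤ suc n →
               (∀ r′ → Sat b (r′ ∷ ρ) σ stay ⇔ toℕ r′ + z ≡ toℕ r) →
               (∀ r′ → Sat b (r′ ∷ ρ) σ wrap ⇔ toℕ r′ + z ≡ suc n + toℕ r) →
               (∀ m r′ → Sat b (r′ ∷ ρ) σ (φ m) ⇔ y ≡ m * suc n + toℕ r′) →
               ∀ m → Sat b ρ σ (addStep stay wrap φ m) ⇔ y + z ≡ m * suc n + toℕ r
    addStep⇔ ρ σ {stay} {wrap} {φ} {y} {z} r z≤N stay⇔ wrap⇔ φ⇔ = λ where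
        zero    → mk⇔ (λ (r′ , p , q) → stays 0 r′ (to (φ⇔ 0 r′) p) (to (stay⇔ r′) q)) from-zero
        (suc m) → mk⇔
          (λ { (r′ , inj₁ (p , q)) → stays (suc m) r′ (to (φ⇔ (suc m) r′) p) (to (stay⇔ r′) q)
             ; (r′ , inj₂ (p , q)) → wraps m r′ (to (φ⇔ m r′) p) (to (wrap⇔ r′) q) })
          (from-suc m)
      where
      open ≡-Reasoning
      R = toℕ r

      stays : ∀ m (r′ : Fin (suc n)) → y ≡ m * suc n + toℕ r′ → toℕ r′ + z ≡ R → y + z ≡ m * suc n + R
      stays m r′ refl eq = trans (+-assoc (m * suc n) (toℕ r′) z) (cong (m * suc n +_) eq)

      wraps : ∀ m (r′ : Fin (suc n)) → y ≡ m * suc n + toℕ r′ → toℕ r′ + z ≡ suc n + R → y + z ≡ suc m * suc n + R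
      wraps m r′ refl eq = begin
        m * suc n + toℕ r′ + z    ≡⟨ +-assoc (m * suc n) (toℕ r′) z ⟩
        m * suc n + (toℕ r′ + z)  ≡⟨ cong (m * suc n +_) eq ⟩
        m * suc n + (suc n + R)   ≡⟨ +-assoc (m * suc n) (suc n) R ⟨
        m * suc n + suc n + R     ≡⟨ cong (_+ R) (+-comm (m * suc n) (suc n)) ⟩
        suc m * suc n + R         ∎

      from-zero : y + z ≡ R → Sat b ρ σ (addStep stay wrap φ 0)
      -- With quotient zero, `y` is at most `R` and is thus its own remainder.
      from-zero eq = fromℕ< y<n , from (φ⇔ 0 _) (sym y≡) , from (stay⇔ _) (trans (cong (_+ z) y≡) eq)
        where
        y<n : y < suc n
        y<n = ≤-<-trans (≤-trans (m≤m+n y z) (≤-reflexive eq)) (toℕ<n r)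
        y≡ = toℕ-fromℕ< y<n

      from-suc : ∀ m → y + z ≡ suc m * suc n + R → Sat b ρ σ (addStep stay wrap φ (suc m))
      -- A carry occurred exactly if `R < z`. The previous remainder is `R ∸ z` without a carry and
      -- `suc n + R ∸ z` with one.
      from-suc m eq with z ≤? R
      ... | yes z≤R = fromℕ< r′<n , inj₁
          ( from (φ⇔ (suc m) _) (trans (+-cancelʳ-≡ z _ _ y≡) (cong (suc m * suc n +_) (sym r′≡)))
          , from (stay⇔ _) (trans (cong (_+ z) r′≡) (m∸n+n≡m z≤R)))
        where
        r′<n : R ∸ z < suc n
        r′<n = ≤-<-trans (m∸n≤m R z) (toℕ<n r)
        r′≡ = toℕ-fromℕ< r′<n
        y≡ : y + z ≡ suc m * suc n + (R ∸ z) + z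
        y≡ = trans eq (trans (cong (suc m * suc n +_) (sym (m∸n+n≡m z≤R))) (sym (+-assoc (suc m * suc n) (R ∸ z) z)))
      ... | no z≰R = fromℕ< r′<n , inj₂
          ( from (φ⇔ m _) (trans (+-cancelʳ-≡ z _ _ y≡) (cong (m * suc n +_) (sym r′≡)))
          , from (wrap⇔ _) (trans (cong (_+ z) r′≡) r′+z))
        where
        r′+z : (suc n + R ∸ z) + z ≡ suc n + R
        r′+z = m∸n+n≡m (≤-trans z≤N (m≤m+n (suc n) R))
        r′<n : suc n + R ∸ z < suc n
        r′<n = +-cancelʳ-< z _ _ (≤-<-trans (≤-reflexive r′+z) (+-monoʳ-< (suc n) (≰⇒> z≰R)))
        r′≡ = toℕ-fromℕ< r′<n
        y≡ : y + z ≡ m * suc n + (suc n + R ∸ z) + z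
        y≡ = begin
          y + z                              ≡⟨ eq ⟩
          suc n + m * suc n + R              ≡⟨ cong (_+ R) (+-comm (suc n) (m * suc n)) ⟩
          m * suc n + suc n + R              ≡⟨ +-assoc (m * suc n) (suc n) R ⟩
          m * suc n + (suc n + R)            ≡⟨ cong (m * suc n +_) r′+z ⟨
          m * suc n + (suc n + R ∸ z + z)    ≡⟨ +-assoc (m * suc n) _ z ⟨
          m * suc n + (suc n + R ∸ z) + z    ∎

    -- The recursion first takes away the `i` units and then the `c` copies of `t`; each removal is
    -- an instance of `addStep⇔`, with `z` equal to 1 or to the value of `t`.
    linear⇔ : ∀ {v k} ρ (σ : Vec (Subset (suc n)) k) c i m (t r : Term v) →
              Sat b ρ σ (linear c i m t r) ⇔
              c * toℕ (value ρ t) + i ≡ m * suc n + toℕ (value ρ r)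
    linear⇔ ρ σ c (suc i) m t r =
      subst (λ y → Sat b ρ σ (linear c (suc i) m t r) ⇔ y ≡ m * suc n + R)
            (trans (+-comm _ 1) (sym (+-suc (c * T) i)))
            (addStep⇔ ρ σ (value ρ r) (s≤s z≤n) stay⇔ wrap⇔ φ⇔ m)
      where
      T = toℕ (value ρ t)
      R = toℕ (value ρ r)

      stay⇔ : ∀ r′ → Sat b (r′ ∷ ρ) σ (isSuc (var Fin.zero) (wk r)) ⇔ toℕ r′ + 1 ≡ R
      stay⇔ r′ = subst₂ (λ x y → Sat b (r′ ∷ ρ) σ (isSuc (var Fin.zero) (wk r)) ⇔ x ≡ y)
        (+-comm 1 (toℕ r′)) (cong toℕ (value-wk r′ ρ r))
        (isSuc⇔ (r′ ∷ ρ) σ (var Fin.zero) (wk r))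

      wrap⇔ : ∀ r′ → Sat {ℒ = ℒ} b (r′ ∷ ρ) σ (and (var Fin.zero ≐ max) (wk r ≐ min)) ⇔ toℕ r′ + 1 ≡ suc n + R
      wrap⇔ r′ = mk⇔
        (λ (p , q) → begin
          toℕ r′ + 1     ≡⟨ cong (λ x → toℕ x + 1) p ⟩
          toℕ (fromℕ n) + 1 ≡⟨ cong (_+ 1) (toℕ-fromℕ n) ⟩
          n + 1          ≡⟨ +-comm n 1 ⟩
          suc n          ≡⟨ +-identityʳ (suc n) ⟨
          suc n + 0      ≡⟨ cong (λ x → suc n + toℕ x) (trans (sym q) (value-wk r′ ρ r)) ⟩
          suc n + R      ∎)
        -- As `r′` is at most `n`, the equation leaves only `R = 0` and `r′ = n`.
        (λ eq →
          let r′≡ : toℕ r′ ≡ n + R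
              r′≡ = suc-injective (trans (+-comm 1 (toℕ r′)) eq)
              R≡0 : R ≡ 0
              R≡0 = n≤0⇒n≡0 (+-cancelˡ-≤ n R 0
                (≤-trans (≤-reflexive (sym r′≡))
                  (≤-trans (s≤s⁻¹ (toℕ<n r′)) (≤-reflexive (sym (+-identityʳ n))))))
          in toℕ-injective (trans r′≡ (trans (cong (n +_) R≡0) (trans (+-identityʳ n) (sym (toℕ-fromℕ n)))))
           , trans (value-wk r′ ρ r) (toℕ-injective R≡0))
        where
        open ≡-Reasoning

      φ⇔ : ∀ m r′ → Sat b (r′ ∷ ρ) σ (linear c i m (wk t) (var Fin.zero)) ⇔ c * T + i ≡ m * suc n + toℕ r′
      φ⇔ m r′ = subst (λ x → Sat b (r′ ∷ ρ) σ (linear c i m (wk t) (var Fin.zero)) ⇔ c * toℕ x + i ≡ m * suc n + toℕ r′)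
        (value-wk r′ ρ t)
        (linear⇔ (r′ ∷ ρ) σ c i m (wk t) (var Fin.zero))
    linear⇔ ρ σ (suc c) zero m t r =
      subst (λ y → Sat b ρ σ (linear (suc c) zero m t r) ⇔ y ≡ m * suc n + R)
            (trans (cong (_+ T) (+-identityʳ (c * T))) (trans (+-comm (c * T) T) (sym (+-identityʳ _))))
            (addStep⇔ ρ σ (value ρ r) (<⇒≤ (toℕ<n (value ρ t))) stay⇔ wrap⇔ φ⇔ m)
      where
      T = toℕ (value ρ t)
      R = toℕ (value ρ r)

      stay⇔ : ∀ r′ → Sat {ℒ = ℒ} b (r′ ∷ ρ) σ (plus (var Fin.zero) (wk t) (wk r)) ⇔ toℕ r′ + T ≡ R
      stay⇔ r′ = ≡⇒⇔ (cong₂ (λ x y → toℕ r′ + toℕ x ≡ toℕ y) (value-wk r′ ρ t) (value-wk r′ ρ r))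

      wrap⇔ : ∀ r′ → Sat b (r′ ∷ ρ) σ (plusWraps (var Fin.zero) (wk t) (wk r)) ⇔ toℕ r′ + T ≡ suc n + R
      wrap⇔ r′ = subst₂ (λ x y → Sat b (r′ ∷ ρ) σ (plusWraps (var Fin.zero) (wk t) (wk r)) ⇔ toℕ r′ + toℕ x ≡ suc n + toℕ y)
        (value-wk r′ ρ t) (value-wk r′ ρ r)
        (plusWraps⇔ (r′ ∷ ρ) σ (var Fin.zero) (wk t) (wk r))

      φ⇔ : ∀ m r′ → Sat b (r′ ∷ ρ) σ (linear c zero m (wk t) (var Fin.zero)) ⇔ c * T + 0 ≡ m * suc n + toℕ r′
      φ⇔ m r′ = subst (λ x → Sat b (r′ ∷ ρ) σ (linear c zero m (wk t) (var Fin.zero)) ⇔ c * toℕ x + 0 ≡ m * suc n + toℕ r′)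
        (value-wk r′ ρ t)
        (linear⇔ (r′ ∷ ρ) σ c zero m (wk t) (var Fin.zero))
    -- The empty sum is 0, which forces quotient and remainder to vanish.
    linear⇔ ρ σ zero zero zero    t r = mk⇔ (λ eq → cong toℕ (sym eq)) (λ eq → toℕ-injective (sym eq))
    linear⇔ ρ σ zero zero (suc m) t r = mk⇔ (λ ()) (λ ())

    samePosition⇔ : ∀ {v k K} ρ (σ : Vec (Subset (suc n)) k) q (i : Fin K) (t : Term v) m r →
                    Sat b ρ σ (samePosition q i t m r) ⇔ SamePosition q i (value ρ t) m (value ρ r)
    samePosition⇔ {K = K} ρ σ one i t m r = ⇔-trans (linear⇔ ρ σ K (toℕ i) (toℕ m) t r)
      (≡⇒⇔ (cong₂ _≡_ (sym (toℕ-combine (value ρ t) i))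
        (trans (cong (_+ toℕ (value ρ r)) (*-comm (toℕ m) (suc n))) (sym (toℕ-combine m (value ρ r))))))
    samePosition⇔ {K = K} ρ σ star i t m r = ⇔-trans (linear⇔ ρ σ K (toℕ m) (toℕ i) r t)
      (⇔-trans (mk⇔ sym sym)
      (≡⇒⇔ (cong₂ _≡_
        (trans (cong (_+ toℕ (value ρ t)) (*-comm (toℕ i) (suc n))) (sym (toℕ-combine i (value ρ t))))
        (sym (toℕ-combine (value ρ r) m)))))

    someIndex⇔ : ∀ {v k} ρ (σ : Vec (Subset (suc n)) k) K (φ : Fin K → Formula s ℒ v k) →
                 Sat b ρ σ (someIndex K φ) ⇔ (∃[ i ] Sat b ρ σ (φ i))
    someIndex⇔ ρ σ zero    φ = mk⇔ (λ ()) (λ ())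
    someIndex⇔ ρ σ (suc K) φ = mk⇔
      (λ { (inj₁ p) → Fin.zero , p
         ; (inj₂ p) → let i , q = to (someIndex⇔ ρ σ K (φ ∘ Fin.suc)) p in Fin.suc i , q })
      (λ { (Fin.zero  , p) → inj₁ p
         ; (Fin.suc i , p) → inj₂ (from (someIndex⇔ ρ σ K (φ ∘ Fin.suc)) (i , p)) })

-- The translation

-- How a set of the original assignment is obtained from the k sets of the new
-- one: it is one of them, or it is the i-th set of the tuple whose q-code is the
-- (flip q)-code of the sets selected by e.
data SetDef (k : ℕ) : Set where
  same    : Fin k → SetDef k
  recoded : ∀ {K} (q : Variant) (i : Fin K) (e : Fin K → Fin k) → SetDef k

renameDef : ∀ {k k′} → (Fin k → Fin k′) → SetDef k → SetDef k′
renameDef f (same X)        = same (f X)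
renameDef f (recoded q i e) = recoded q i (f ∘ e)

infix 4 _∈⟦_⟧_

_∈⟦_⟧_ : ∀ {n k} → Fin n → SetDef k → Vec (Subset n) k → Set
j ∈⟦ same X ⟧ σ        = j ∈ lookup σ X
j ∈⟦ recoded q i e ⟧ σ = ∃[ r ] ∃[ m ] SamePosition q i j m r × r ∈ lookup σ (e m)

renameDef⇔ : ∀ {n k k′} (f : Fin k → Fin k′) {σ : Vec (Subset n) k} {σ′} →
             (∀ X → lookup σ′ (f X) ≡ lookup σ X) →
             ∀ d {j} → j ∈⟦ d ⟧ σ ⇔ j ∈⟦ renameDef f d ⟧ σ′
renameDef⇔ f σ≡ (same X) {j} = ≡⇒⇔ (cong (j ∈_) (sym (σ≡ X)))
renameDef⇔ f σ≡ (recoded q i e) =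
  ∃-cong λ {r} → ∃-cong λ {m} → ⇔-refl ×-⇔ ≡⇒⇔ (cong (r ∈_) (sym (σ≡ (e m))))

-- The element `r` ranges over the universe and is quantified in the formula, while the index `m`
-- has constant range and becomes a disjunction. The formula is first-order, hence available in
-- every `ℒ`.
memberOf : ∀ {s ℒ v k} → SetDef k → Term v → Formula s ℒ v k
memberOf (same X) t = member X t
memberOf (recoded {K} q i e) t =
  exists (someIndex K λ m → and (samePosition q i (wk t) m (var Fin.zero)) (member (e m) (var Fin.zero)))

memberOf⇔ : ∀ {s ℒ n v k} (b : Str s n) ρ (σ : Vec (Subset (suc n)) k) d (t : Term v) →
            Sat b ρ σ (memberOf {ℒ = ℒ} d t) ⇔ value ρ t ∈⟦ d ⟧ σ
memberOf⇔ b ρ σ (same X) t = ⇔-refl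
memberOf⇔ b ρ σ (recoded {K} q i e) t =
  ∃-cong λ {r} → ⇔-trans (someIndex⇔ b (r ∷ ρ) σ K _)
    (∃-cong λ {m} →
      subst (λ x → Sat b (r ∷ ρ) σ (samePosition q i (wk t) m (var Fin.zero)) ⇔ SamePosition q i x m r)
            (value-wk r ρ t) (samePosition⇔ b (r ∷ ρ) σ q i (wk t) m (var Fin.zero))
      ×-⇔ ⇔-refl)

-- Set definitions under binders

SetDefs : ℕ → Set
SetDefs k = Fin k → SetDef k

infix 4 _⊨_≈_

-- The invariant of the translation: `σ` interprets the original formula and `σ′` the translated
-- one, with the same set variables in scope.
_⊨_≈_ : ∀ {n k} → SetDefs k → Vec (Subset n) k → Vec (Subset n) k → Set
θ ⊨ σ ≈ σ′ = ∀ X {j} → j ∈ lookup σ X ⇔ j ∈⟦ θ X ⟧ σ′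

bindSet : ∀ {k} → SetDefs k → SetDefs (suc k)
bindSet θ Fin.zero    = same Fin.zero
bindSet θ (Fin.suc X) = renameDef Fin.suc (θ X)

bindSet-≈ : ∀ {n k} {θ : SetDefs k} {σ σ′ : Vec (Subset n) k} {A} → θ ⊨ σ ≈ σ′ → bindSet θ ⊨ A ∷ σ ≈ A ∷ σ′
bindSet-≈ inv Fin.zero = ⇔-refl
bindSet-≈ {θ = θ} inv (Fin.suc X) = ⇔-trans (inv X) (renameDef⇔ Fin.suc (λ _ → refl) (θ X))

-- The newly bound block is recoded as a whole. Older definitions keep referring to their own blocks
-- and are only shifted past the new variables.
bindRecoded : ∀ {k} q K → SetDefs k → SetDefs (K + k)
bindRecoded {k} q K θ X = [ (λ i → recoded q i (_↑ˡ k)) , (λ Y → renameDef (K ↑ʳ_) (θ Y)) ]′ (splitAt K X)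

recodedAll : ∀ q K → SetDefs K
recodedAll q K i = recoded q i (λ m → m)

-- Equal codes carry the same bit at equal positions, and since their lengths agree every position
-- of one code is a position of the other.
recoded-≈ : ∀ {n K} q (As Bs : Vec (Subset n) K) → code q As ≡ code (flip q) Bs → recodedAll q K ⊨ As ≈ Bs
recoded-≈ {n} {K} q As Bs eq i {j} = mk⇔ to′ from′
  where
  agree : ∀ {m r} → SamePosition q i j m r → lookup (lookup As i) j ≡ lookup (lookup Bs m) r
  agree {m} {r} pos = begin
    lookup (lookup As i) j                       ≡⟨ lookup-bits q As i j ⟨
    lookup (bits q As) (index q i j)             ≡⟨ toList-lookup (bits q As) (bits (flip q) Bs) bits≡ pos ⟩
    lookup (bits (flip q) Bs) (index (flip q) m r) ≡⟨ lookup-bits (flip q) Bs m r ⟩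
    lookup (lookup Bs m) r                       ∎
    where
    open ≡-Reasoning
    bits≡ = trans (sym (code≡bits q As)) (trans eq (code≡bits (flip q) Bs))

  to′ : j ∈ lookup As i → j ∈⟦ recoded q i (λ m → m) ⟧ Bs
  to′ j∈A with m , r , index≡ ← index-surjective (flip q) (Fin.cast (codeLength-flip q n K) (index q i j)) =
    r , m , pos , lookup⇒[]= r (lookup Bs m) (trans (sym (agree pos)) ([]=⇒lookup j∈A))
    where
    pos : SamePosition q i j m r
    pos = sym (trans (cong toℕ index≡) (toℕ-cast (codeLength-flip q n K) (index q i j)))

  from′ : j ∈⟦ recoded q i (λ m → m) ⟧ Bs → j ∈ lookup As i
  from′ (r , m , pos , r∈B) = lookup⇒[]= j (lookup As i) (trans (agree pos) ([]=⇒lookup r∈B))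

bindRecoded-≈ : ∀ {n k} q K {θ : SetDefs k} {σ σ′ : Vec (Subset n) k} (As Bs : Vec (Subset n) K) →
                θ ⊨ σ ≈ σ′ → code q As ≡ code (flip q) Bs →
                bindRecoded q K θ ⊨ As Vec.++ σ ≈ Bs Vec.++ σ′
bindRecoded-≈ {k = k} q K {θ} {σ} {σ′} As Bs inv eq X {j}
  -- This makes the lookup in `As ++ σ` branch on the same `splitAt` as `bindRecoded`.
  rewrite lookup-splitAt K As σ X with splitAt K X
... | inj₁ i = ⇔-trans (recoded-≈ q As Bs eq i) (renameDef⇔ (_↑ˡ k) {Bs} {Bs Vec.++ σ′} (lookup-++ˡ Bs σ′) (recodedAll q K i))
... | inj₂ Y = ⇔-trans (inv Y) (renameDef⇔ (K ↑ʳ_) (lookup-++ʳ Bs σ′) (θ Y))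

flipLogic : Logic → Logic
flipLogic FO      = FO
flipLogic (SOM q) = SOM (flip q)

translate : ∀ {s ℒ v k} → SetDefs k → Formula s ℒ v k → Formula s (flipLogic ℒ) v k
translate θ (t ≐ u)       = t ≐ u
translate θ (t ≺ u)       = t ≺ u
translate θ (letter a t)  = letter a t
translate θ (member X t)  = memberOf (θ X) t
translate θ (plus t u r)  = plus t u r
translate θ (times t u r) = times t u r
translate θ (neg φ)       = neg (translate θ φ)
translate θ (and φ ψ)     = and (translate θ φ) (translate θ ψ)
translate θ (or φ ψ)      = or (translate θ φ) (translate θ ψ)
translate θ (imp φ ψ)     = imp (translate θ φ) (translate θ ψ)
translate θ (exists φ)    = exists (translate θ φ)
translate θ (forAll φ)    = forAll (translate θ φ)
translate θ (existsSet φ) = existsSet (translate (bindSet θ) φ)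
translate θ (forAllSet φ) = forAllSet (translate (bindSet θ) φ)
translate θ (monoidQ {q} M S ℓ φ) = monoidQ M S ℓ λ j → translate (bindRecoded q (suc ℓ) θ) (φ j)

-- Lindström quantifiers under a change of code

IsLetter-resp : ∀ {s} {P Q : Fin s → Set} → (∀ j → P j ⇔ Q j) → ∀ {a} → IsLetter P a → IsLetter Q a
IsLetter-resp P⇔Q (here , before) =
  (λ j j≡a → to (P⇔Q j) (here j j≡a)) , (λ j j<a q → before j j<a (from (P⇔Q j) q))

-- The same word `w` works: its letters are listed by codes, and each assignment is replaced by one
-- with the same code that satisfies corresponding formulas.
Lindström-⊆ : ∀ {s n k} q q′ (L : Language (suc s)) {P Q : Vec (Subset n) k → Fin s → Set} →
              (∀ As → ∃[ Bs ] code q′ Bs ≡ code q As × (∀ j → P As j ⇔ Q Bs j)) →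
              Lindström q L n k P → Lindström q′ L n k Q
Lindström-⊆ q q′ L simulate (w , letters , w∈L) =
  w ,
  Pointwise.map
    (λ (As , code≡ , isLetter) →
      let Bs , Bs≡ , P⇔Q = simulate As in Bs , trans Bs≡ code≡ , IsLetter-resp P⇔Q isLetter)
    letters ,
  w∈L

flip-involutive : ∀ q → flip (flip q) ≡ q
flip-involutive one  = refl
flip-involutive star = refl

Lindström-flip : ∀ {s n k} q (L : Language (suc s)) {P Q : Vec (Subset n) k → Fin s → Set} →
                 (∀ As Bs → code q As ≡ code (flip q) Bs → ∀ j → P As j ⇔ Q Bs j) →
                 Lindström q L n k P ⇔ Lindström (flip q) L n k Q
Lindström-flip q L P⇔Q = mk⇔
  (Lindström-⊆ q (flip q) L λ As →
    let Bs , eq = recode q As in Bs , eq , P⇔Q As Bs (sym eq))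
  (Lindström-⊆ (flip q) q L λ Bs →
    let As , eq = recode (flip q) Bs
        -- Decoding from `flip q` gives the variant `flip (flip q)`, which reduces to `q` only after
        -- a case distinction.
        eq′ = subst (λ q′ → code q′ As ≡ code (flip q) Bs) (flip-involutive q) eq
    in As , eq′ , λ j → ⇔-sym (P⇔Q As Bs eq′ j))

-- Correctness of the translation and the equivalences

translate⇔ : ∀ {s n ℒ v k} (b : Str s n) ρ {σ σ′ : Vec (Subset (suc n)) k} {θ} → θ ⊨ σ ≈ σ′ →
             (φ : Formula s ℒ v k) → Sat b ρ σ φ ⇔ Sat b ρ σ′ (translate θ φ)
translate⇔ b ρ inv (t ≐ u)       = ⇔-refl
translate⇔ b ρ inv (t ≺ u)       = ⇔-refl
translate⇔ b ρ inv (letter a t)  = ⇔-refl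
translate⇔ b ρ {σ′ = σ′} {θ} inv (member X t) = ⇔-trans (inv X) (⇔-sym (memberOf⇔ b ρ σ′ (θ X) t))
translate⇔ b ρ inv (plus t u r)  = ⇔-refl
translate⇔ b ρ inv (times t u r) = ⇔-refl
translate⇔ b ρ inv (neg φ)       = ¬-cong-⇔ (translate⇔ b ρ inv φ)
translate⇔ b ρ inv (and φ ψ)     = translate⇔ b ρ inv φ ×-⇔ translate⇔ b ρ inv ψ
translate⇔ b ρ inv (or φ ψ)      = translate⇔ b ρ inv φ ⊎-⇔ translate⇔ b ρ inv ψ
translate⇔ b ρ inv (imp φ ψ)     = →-cong-⇔ (translate⇔ b ρ inv φ) (translate⇔ b ρ inv ψ)
translate⇔ b ρ inv (exists φ)    = ∃-cong λ {i} → translate⇔ b (i ∷ ρ) inv φ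
translate⇔ b ρ inv (forAll φ)    = ∀-cong λ i → translate⇔ b (i ∷ ρ) inv φ
translate⇔ b ρ inv (existsSet φ) = ∃-cong (translate⇔ b ρ (bindSet-≈ inv) φ)
translate⇔ b ρ inv (forAllSet φ) = ∀-cong λ A → translate⇔ b ρ (bindSet-≈ inv) φ
translate⇔ b ρ inv (monoidQ {q} M S ℓ φ) =
  -- The equality of codes supplied here is what extends the invariant to the newly bound block.
  Lindström-flip q (wordProblem M S) λ As Bs eq j →
    translate⇔ b ρ (bindRecoded-≈ q (suc ℓ) As Bs inv eq) (φ j)

-- The outer quantifier binds all set variables, so every one of them is recoded; the inner formulas
-- remain first-order because `flipLogic` fixes `FO`.
QMonFO-flip : ∀ q → QMonFO q ⊑ QMonFO (flip q)
QMonFO-flip q s Φ =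
  record { M = M ; S = S ; ℓ = ℓ ; φ = λ j → translate (recodedAll q (suc ℓ)) (φ j) } ,
  λ b → Lindström-flip q (wordProblem M S) λ As Bs eq j → translate⇔ b [] (recoded-≈ q As Bs eq) (φ j)
  where open MonoidFOSentence Φ

SOMQMon-flip : ∀ q → SOMQMon q ⊑ SOMQMon (flip q)
SOMQMon-flip q s φ = translate (λ ()) φ , λ b → translate⇔ b [] (λ ()) φ

theorem4p2 : (QMonFO one ≋ QMonFO star) × (SOMQMon one ≋ SOMQMon star)
theorem4p2 = (QMonFO-flip one , QMonFO-flip star) , (SOMQMon-flip one , SOMQMon-flip star)
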